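{- For every positive integer $n$ there exists a complete geometric graph on $n$ points whose edge set can be partitioned into $\lceil n/2\rceil+1$ plane star-forests.
   Context: A complete geometric graph on a finite point set $P\subset\mathbb{R}^2$ in general position (no three collinear) is the complete graph on $P$ with edges drawn as straight line segments. A subgraph is plane if no two of its edges cross. A star is a connected graph with one vertex (the center) adjacent to all other vertices and no other edges; a star-forest is a forest each of whose components is a star. -}

module Defs where

open import Data.Nat using (ℕ)
open import Data.Integer using (ℤ; _-_; _*_; _<_; 0ℤ)
open import Data.Fin using (Fin)
open import Data.Product using (_×_; _,_; proj₁; proj₂; ∃)
open import Data.Sum using (_⊎_)
open import Relation.Binary.PropositionalEquality using (_≡_; _≢_)

-- Points of the plane with integer coordinates (see NOTES.md, FIDELITY).
Point : Set
Point = ℤ × ℤ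

-- Orientation determinant of the triple (a, b, c):
-- positive = counterclockwise, negative = clockwise, zero = collinear.
orient : Point → Point → Point → ℤ
orient (ax , ay) (bx , by) (cx , cy) =
  ((bx - ax) * (cy - ay)) - ((by - ay) * (cx - ax))

-- A point configuration of n points in general position:
-- distinct labels give distinct points, and no three are collinear.
GeneralPosition : {n : ℕ} → (Fin n → Point) → Set
GeneralPosition {n} p =
  (∀ i j → i ≢ j → p i ≢ p j) ×
  (∀ i j k → i ≢ j → j ≢ k → i ≢ k → orient (p i) (p j) (p k) ≢ 0ℤ)

-- For points in general position, the closed segments ab and cd
-- (a,b,c,d pairwise distinct) cross iff c,d lie strictly on opposite
-- sides of line ab and a,b lie strictly on opposite sides of line cd.
-- Segments sharing an endpoint meet only at that endpoint (no three
-- points collinear), so they do not cross.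
Crosses : {n : ℕ} → (Fin n → Point) → Fin n → Fin n → Fin n → Fin n → Set
Crosses p a b c d =
  (a ≢ b) × (a ≢ c) × (a ≢ d) × (b ≢ c) × (b ≢ d) × (c ≢ d) ×
  ((orient (p a) (p b) (p c) * orient (p a) (p b) (p d)) < 0ℤ) ×
  ((orient (p c) (p d) (p a) * orient (p c) (p d) (p b)) < 0ℤ)

-- A (spanning) subgraph of the complete graph on Fin n, given by an
-- adjacency relation; only pairs of distinct vertices are considered edges.
Graph : ℕ → Set₁
Graph n = Fin n → Fin n → Set

Edge : {n : ℕ} → Graph n → Fin n → Fin n → Set
Edge H u v = (u ≢ v) × H u v

-- Plane: no two edges cross.
Plane : {n : ℕ} → (Fin n → Point) → Graph n → Set
Plane p H = ∀ a b c d → Edge H a b → Edge H c d → Crosses p a b c d → Data.Empty.⊥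
  where import Data.Empty

-- Star-forest: the vertex set is split into components, each component
-- being a star.  ctr v is the center of the component containing v;
-- the components are the fibres of ctr, each containing its center,
-- and the edges are exactly the center-to-other-vertex pairs inside
-- a component.
StarForest : {n : ℕ} → Graph n → Set
StarForest {n} H = ∃ λ (ctr : Fin n → Fin n) →
  (∀ v → ctr (ctr v) ≡ ctr v) ×
  (∀ u v → Edge H u v →
     (ctr u ≡ ctr v) × ((u ≡ ctr u) ⊎ (v ≡ ctr v))) ×
  (∀ u v → u ≢ v → ctr u ≡ ctr v → ((u ≡ ctr u) ⊎ (v ≡ ctr v)) → H u v)

-- Colour class i of an edge colouring.
ColourClass : {n k : ℕ} → (Fin n → Fin n → Fin k) → Fin k → Graph n
ColourClass col i u v = col u v ≡ i

-- A partition of the edges of the complete graph K_n into k classes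
-- (possibly empty): a symmetric colouring of the pairs by Fin k.
-- Each class is a plane star-forest with respect to the drawing p.
PlaneStarForestPartition : {n : ℕ} → (Fin n → Point) → ℕ → Set
PlaneStarForestPartition {n} p k = ∃ λ (col : Fin n → Fin n → Fin k) →
  (∀ u v → col u v ≡ col v u) ×
  (∀ i → StarForest (ColourClass col i) × Plane p (ColourClass col i))

{-# OPTIONS --safe #-}
module Submission where

open import Data.Bool using (Bool; true; false; not)
open import Data.Bool.Properties using (not-involutive; not-¬)
open import Data.Empty using (⊥; ⊥-elim)
open import Data.Fin using (Fin; toℕ; fromℕ<)
open import Data.Fin.Properties using (toℕ-injective; toℕ-fromℕ<; toℕ<n)
open import Data.Nat as ℕ using (ℕ; zero; suc; z≤n; s≤s; _<_; _≤_; _^_; _⊔_; _⊓_; ⌈_/2⌉)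
import Data.Nat.Properties as ℕ
open import Data.Product using (∃; ∄; _×_; _,_; proj₁; proj₂; map₁; map₂)
open import Data.Sign as Sign using (Sign; opposite)
import Data.Sign.Properties as Sign
open import Data.Sum as Sum using (_⊎_; inj₁; inj₂)
open import Function using (_$_; _∘_; _⇔_; mk⇔; Equivalence)
open import Relation.Binary.Definitions using (tri<; tri≈; tri>)
open import Relation.Binary.PropositionalEquality
open import Relation.Nullary using (¬_; Dec; yes; no)

open import Defs

-- The points lie on the cubic y = x³ at x = 3⁰, -3¹, 3², -3³, …  The orientation of three
-- points of the cubic with abscissae a, b, c is (b - a)(c - a)(c - b)(a + b + c), and since
-- each |x| exceeds the sum of all earlier ones, its sign depends only on the order and the
-- parities of the indices.  Group the points into pairs {2k, 2k + 1}.  Colour 0 is the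
-- matching of the pairs; colour k + 1 consists of two stars, centred at the two points of
-- pair k, each joining its centre to the earlier points of the same parity and to the later
-- points of the other parity.  On the infinite sequence these classes are star forests by
-- construction, and they stay so on the first n points, where a vertex whose centre is
-- missing becomes isolated.  The sign rule shows that no two edges of one class cross.

record IsStarForest {X : Set} (H : X → X → Set) (ctr : X → X) : Set where
  field
    ctr-idem : ∀ v → ctr (ctr v) ≡ ctr v
    edge⇒star : ∀ {u v} → u ≢ v → H u v → ctr u ≡ ctr v × (u ≡ ctr u ⊎ v ≡ ctr v)
    star⇒edge : ∀ {u v} → u ≢ v → ctr u ≡ ctr v → (u ≡ ctr u ⊎ v ≡ ctr v) → H u v

isStarForest⇒starForest : ∀ {n} {H : Graph n} {ctr} → IsStarForest H ctr → StarForest H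
isStarForest⇒starForest {ctr = ctr} F =
  ctr , ctr-idem , (λ _ _ (u≢v , uv) → edge⇒star u≢v uv) , (λ _ _ → star⇒edge)
  where open IsStarForest F

isStarForest-resp-⇔ : ∀ {X : Set} {H H' : X → X → Set} {ctr} →
                      (∀ {u v} → H u v ⇔ H' u v) → IsStarForest H ctr → IsStarForest H' ctr
isStarForest-resp-⇔ H⇔H' F = record
  { ctr-idem = ctr-idem
  ; edge⇒star = λ u≢v → edge⇒star u≢v ∘ Equivalence.from H⇔H'
  ; star⇒edge = λ u≢v same centred → Equivalence.to H⇔H' (star⇒edge u≢v same centred)
  }
  where open IsStarForest F

module Restriction {X : Set} {n : ℕ} (ι : Fin n → X) (ι-injective : ∀ {a b} → ι a ≡ ι b → a ≡ b)
                (preimage? : ∀ x → Dec (∃ λ a → ι a ≡ x))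
                {H : X → X → Set} {f : X → X} (F : IsStarForest H f) where

  open IsStarForest F

  restrict : Fin n → Fin n
  restrict a with preimage? (f (ι a))
  ... | yes (a' , _) = a'
  ... | no _ = a

  restrict-cases : ∀ a → ι (restrict a) ≡ f (ι a) ⊎ (restrict a ≡ a × ∄ λ a' → ι a' ≡ f (ι a))
  restrict-cases a with preimage? (f (ι a))
  ... | yes (_ , ιa'≡fιa) = inj₁ ιa'≡fιa
  ... | no ∄a' = inj₂ (refl , ∄a')

  restrict-of-centre : ∀ {a b} → f (ι b) ≡ ι a → restrict b ≡ a
  restrict-of-centre {a} {b} fιb≡ιa with restrict-cases b
  ... | inj₁ hit = ι-injective (trans hit fιb≡ιa)
  ... | inj₂ (_ , ∄a') = ⊥-elim (∄a' (a , sym fιb≡ιa))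

  centre-of-restrict : ∀ {a b} → a ≢ b → restrict b ≡ a → f (ι b) ≡ ι a
  centre-of-restrict {a} {b} a≢b rb≡a with restrict-cases b
  ... | inj₁ hit = trans (sym hit) (cong ι rb≡a)
  ... | inj₂ (rb≡b , _) = ⊥-elim (a≢b (trans (sym rb≡a) rb≡b))

  ι-≢ : ∀ {a b} → a ≢ b → ι a ≢ ι b
  ι-≢ a≢b = a≢b ∘ ι-injective

  restrict-idem : ∀ a → restrict (restrict a) ≡ restrict a
  restrict-idem a with restrict-cases a
  ... | inj₁ hit = restrict-of-centre (trans (cong f hit) (trans (ctr-idem (ι a)) (sym hit)))
  ... | inj₂ (ra≡a , _) = cong restrict ra≡a

  restrict-edge⇒star : ∀ {a b} → a ≢ b → H (ι a) (ι b) →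
                       restrict a ≡ restrict b × (a ≡ restrict a ⊎ b ≡ restrict b)
  restrict-edge⇒star {a} {b} a≢b ab with edge⇒star (ι-≢ a≢b) ab
  ... | same , inj₁ a-centre = trans ra≡a (sym rb≡a) , inj₁ (sym ra≡a)
    where
    ra≡a : restrict a ≡ a
    ra≡a = restrict-of-centre (sym a-centre)
    rb≡a : restrict b ≡ a
    rb≡a = restrict-of-centre (trans (sym same) (sym a-centre))
  ... | same , inj₂ b-centre = trans ra≡b (sym rb≡b) , inj₂ (sym rb≡b)
    where
    ra≡b : restrict a ≡ b
    ra≡b = restrict-of-centre (trans same (sym b-centre))
    rb≡b : restrict b ≡ b
    rb≡b = restrict-of-centre (sym b-centre)

  restrict-star⇒edge : ∀ {a b} → a ≢ b → restrict a ≡ restrict b → (a ≡ restrict a ⊎ b ≡ restrict b) →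
                       H (ι a) (ι b)
  restrict-star⇒edge {a} {b} a≢b same (inj₁ a-fixed) =
    star⇒edge (ι-≢ a≢b) (trans fιa≡ιa (sym fιb≡ιa)) (inj₁ (sym fιa≡ιa))
    where
    fιb≡ιa : f (ι b) ≡ ι a
    fιb≡ιa = centre-of-restrict a≢b (trans (sym same) (sym a-fixed))
    fιa≡ιa : f (ι a) ≡ ι a
    fιa≡ιa = trans (cong f (sym fιb≡ιa)) (trans (ctr-idem (ι b)) fιb≡ιa)
  restrict-star⇒edge {a} {b} a≢b same (inj₂ b-fixed) =
    star⇒edge (ι-≢ a≢b) (trans fιa≡ιb (sym fιb≡ιb)) (inj₂ (sym fιb≡ιb))
    where
    fιa≡ιb : f (ι a) ≡ ι b
    fιa≡ιb = centre-of-restrict (a≢b ∘ sym) (trans same (sym b-fixed))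
    fιb≡ιb : f (ι b) ≡ ι b
    fιb≡ιb = trans (cong f (sym fιa≡ιb)) (trans (ctr-idem (ι a)) fιa≡ιb)

  restrict-isStarForest : IsStarForest (λ a b → H (ι a) (ι b)) restrict
  restrict-isStarForest = record
    { ctr-idem = restrict-idem
    ; edge⇒star = restrict-edge⇒star
    ; star⇒edge = restrict-star⇒edge
    }

-- (j , t) is the point of index 2j + 1 if t and 2j otherwise: parity t in pair j.
Vertex : Set
Vertex = ℕ × Bool

index : Vertex → ℕ
index (zero , false) = 0
index (zero , true) = 1
index (suc j , t) = suc (suc (index (j , t)))

vertex : ℕ → Vertex
vertex 0 = 0 , false
vertex 1 = 0 , true
vertex (suc (suc i)) = map₁ suc (vertex i)

index-vertex : ∀ i → index (vertex i) ≡ i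
index-vertex 0 = refl
index-vertex 1 = refl
index-vertex (suc (suc i)) = cong (suc ∘ suc) (index-vertex i)

vertex-index : ∀ u → vertex (index u) ≡ u
vertex-index (zero , false) = refl
vertex-index (zero , true) = refl
vertex-index (suc j , t) = cong (map₁ suc) (vertex-index (j , t))

index-injective : ∀ {u w} → index u ≡ index w → u ≡ w
index-injective {u} {w} eq = trans (sym (vertex-index u)) (trans (cong vertex eq) (vertex-index w))

index-<-pair : ∀ {j j'} t t' → j < j' → index (j , t) < index (j' , t')
index-<-pair {zero} {suc _} false _ _ = s≤s z≤n
index-<-pair {zero} {suc _} true _ _ = s≤s (s≤s z≤n)
index-<-pair {suc _} {suc _} t t' (s≤s j<j') = s≤s (s≤s (index-<-pair t t' j<j'))

index-false<true : ∀ j → index (j , false) < index (j , true)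
index-false<true zero = s≤s z≤n
index-false<true (suc j) = s≤s (s≤s (index-false<true j))

index-≤-pair : ∀ {j j'} → j ≤ j' → index (j , false) < index (j' , true)
index-≤-pair j≤j' with ℕ.m≤n⇒m<n∨m≡n j≤j'
... | inj₁ j<j' = index-<-pair false true j<j'
... | inj₂ refl = index-false<true _

vertex-pair-< : ∀ {i n} → i < n → proj₁ (vertex i) < ⌈ n /2⌉
vertex-pair-< {0} {suc _} _ = s≤s z≤n
vertex-pair-< {1} {1} (s≤s ())
vertex-pair-< {1} {suc (suc _)} _ = s≤s z≤n
vertex-pair-< {suc (suc i)} {suc (suc n)} (s≤s (s≤s i<n)) = s≤s (vertex-pair-< i<n)

sgn : Vertex → Sign
sgn (_ , false) = Sign.+
sgn (_ , true) = Sign.-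

module CubicOrientation where

  open import Data.Integer using (ℤ; +_; -[1+_]; _◃_; ∣_∣; 0ℤ; _+_; _-_; _*_; -_)
  import Data.Integer as ℤ
  import Data.Integer.Properties as ℤ
  open import Data.Integer.Tactic.RingSolver using (solve-∀)
  open import Data.Nat.Tactic.RingSolver using () renaming (solve-∀ to ℕ-solve-∀)

  HasSign : Sign → ℤ → Set
  HasSign s x = ∃ λ k → x ≡ s ◃ suc k

  hasSign-* : ∀ {s t x y} → HasSign s x → HasSign t y → HasSign (s Sign.* t) (x * y)
  hasSign-* {Sign.+} {Sign.+} (_ , refl) (_ , refl) = _ , refl
  hasSign-* {Sign.+} {Sign.-} (_ , refl) (_ , refl) = _ , refl
  hasSign-* {Sign.-} {Sign.+} (_ , refl) (_ , refl) = _ , refl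
  hasSign-* {Sign.-} {Sign.-} (_ , refl) (_ , refl) = _ , refl

  hasSign-neg : ∀ {s x} → HasSign s x → HasSign (opposite s) (- x)
  hasSign-neg {Sign.+} (k , refl) = k , refl
  hasSign-neg {Sign.-} (k , refl) = k , refl

  hasSign⇒≢0 : ∀ {s x} → HasSign s x → x ≢ 0ℤ
  hasSign⇒≢0 {Sign.+} (_ , refl) ()
  hasSign⇒≢0 {Sign.-} (_ , refl) ()

  hasSign⁺⇒≮0 : ∀ {x} → HasSign Sign.+ x → ¬ x ℤ.< 0ℤ
  hasSign⁺⇒≮0 (_ , refl) (ℤ.+<+ ())

  hasSign-dominant⁺ : ∀ {M} y → ∣ y ∣ < M → HasSign Sign.+ ((Sign.+ ◃ M) + y)
  hasSign-dominant⁺ {suc M} (+ j) _ = M ℕ.+ j , refl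
  hasSign-dominant⁺ {suc (suc M)} -[1+ j ] (s≤s (s≤s j≤M)) = M ℕ.∸ j , (begin
    suc (suc M) ℤ.⊖ suc j  ≡⟨ ℤ.[1+m]⊖[1+n]≡m⊖n (suc M) j ⟩
    suc M ℤ.⊖ j            ≡⟨ ℤ.⊖-≥ (ℕ.m≤n⇒m≤1+n j≤M) ⟩
    + (suc M ℕ.∸ j)        ≡⟨ cong +_ (ℕ.+-∸-assoc 1 j≤M) ⟩
    + suc (M ℕ.∸ j)        ∎)
    where open ≡-Reasoning

  hasSign-dominant : ∀ s {M} y → ∣ y ∣ < M → HasSign s ((s ◃ M) + y)
  hasSign-dominant Sign.+ y lt = hasSign-dominant⁺ y lt
  hasSign-dominant Sign.- {M} y lt = subst (HasSign Sign.-) eq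
      (hasSign-neg (hasSign-dominant⁺ (- y) (subst (_< M) (sym (ℤ.∣-i∣≡∣i∣ y)) lt)))
    where
    eq : - ((Sign.+ ◃ M) + - y) ≡ (Sign.- ◃ M) + y
    eq = trans (ℤ.neg-distrib-+ (Sign.+ ◃ M) (- y))
               (cong₂ _+_ (trans (cong -_ (ℤ.+◃n≡+n M)) (sym (ℤ.-◃n≡-n M))) (ℤ.neg-involutive y))

  orient-rotate : ∀ a b c → orient a b c ≡ orient b c a
  orient-rotate (ax , ay) (bx , by) (cx , cy) = rotate ax ay bx by cx cy
    where
    rotate : ∀ ax ay bx by cx cy →
      (bx - ax) * (cy - ay) - (by - ay) * (cx - ax) ≡ (cx - bx) * (ay - by) - (cy - by) * (ax - bx)
    rotate = solve-∀

  orient-swap : ∀ a b c → orient a b c ≡ - orient b a c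
  orient-swap (ax , ay) (bx , by) (cx , cy) = swap ax ay bx by cx cy
    where
    swap : ∀ ax ay bx by cx cy →
      (bx - ax) * (cy - ay) - (by - ay) * (cx - ax) ≡ - ((ax - bx) * (cy - by) - (ay - by) * (cx - bx))
    swap = solve-∀

  cubic : ℤ → Point
  cubic x = x , x * x * x

  orient-cubic : ∀ a b c → orient (cubic a) (cubic b) (cubic c) ≡ (b - a) * (c - a) * (c - b) * (a + b + c)
  orient-cubic a b c = factorise a b c
    where
    factorise : ∀ a b c → (b - a) * (c * c * c - a * a * a) - (b * b * b - a * a * a) * (c - a)
                          ≡ (b - a) * (c - a) * (c - b) * (a + b + c)
    factorise = solve-∀

  record Separates (a b c d : Point) : Set where
    constructor separates
    field negative : orient a b c * orient a b d ℤ.< 0ℤ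

  separates-swapˡ : ∀ {a b c d} → Separates a b c d → Separates b a c d
  separates-swapˡ {a} {b} {c} {d} (separates neg) = separates (subst (ℤ._< 0ℤ) (begin
      orient a b c * orient a b d          ≡⟨ neg*neg (orient a b c) (orient a b d) ⟨
      - orient a b c * - orient a b d      ≡⟨ cong₂ _*_ (orient-swap b a c) (orient-swap b a d) ⟨
      orient b a c * orient b a d          ∎) neg)
    where
    open ≡-Reasoning
    neg*neg : ∀ x y → - x * - y ≡ x * y
    neg*neg = solve-∀

  separates-swapʳ : ∀ {a b c d} → Separates a b c d → Separates a b d c
  separates-swapʳ {a} {b} {c} {d} (separates neg) =
    separates (subst (ℤ._< 0ℤ) (ℤ.*-comm (orient a b c) (orient a b d)) neg)

  Crossing : Point → Point → Point → Point → Set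
  Crossing a b c d = Separates a b c d × Separates c d a b

  crossing-sym : ∀ {a b c d} → Crossing a b c d → Crossing c d a b
  crossing-sym (ab , cd) = cd , ab

  crossing-swapˡ : ∀ {a b c d} → Crossing a b c d → Crossing b a c d
  crossing-swapˡ (ab , cd) = separates-swapˡ ab , separates-swapʳ cd

  crossing-swapʳ : ∀ {a b c d} → Crossing a b c d → Crossing a b d c
  crossing-swapʳ (ab , cd) = separates-swapʳ ab , separates-swapˡ cd

  xcoord : Vertex → ℤ
  xcoord u = sgn u ◃ 3 ^ index u

  point : Vertex → Point
  point u = cubic (xcoord u)

  ∣xcoord∣ : ∀ u → ∣ xcoord u ∣ ≡ 3 ^ index u
  ∣xcoord∣ u = ℤ.abs-◃ (sgn u) (3 ^ index u)

  3^-mono-< : ∀ {a b} → a < b → 3 ^ a < 3 ^ b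
  3^-mono-< = ℕ.^-monoʳ-< 3 (s≤s (s≤s z≤n))

  3^-injective : ∀ {a b} → 3 ^ a ≡ 3 ^ b → a ≡ b
  3^-injective {a} {b} eq with ℕ.<-cmp a b
  ... | tri< a<b _ _ = ⊥-elim (ℕ.<-irrefl eq (3^-mono-< a<b))
  ... | tri≈ _ a≡b _ = a≡b
  ... | tri> _ _ b<a = ⊥-elim (ℕ.<-irrefl (sym eq) (3^-mono-< b<a))

  3^-sum-< : ∀ {a b c} → a < c → b < c → 3 ^ a ℕ.+ 3 ^ b < 3 ^ c
  3^-sum-< {a} {b} {suc c} (s≤s a≤c) (s≤s b≤c) = begin-strict
    3 ^ a ℕ.+ 3 ^ b              ≤⟨ ℕ.+-mono-≤ (ℕ.^-monoʳ-≤ 3 a≤c) (ℕ.^-monoʳ-≤ 3 b≤c) ⟩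
    3 ^ c ℕ.+ 3 ^ c              <⟨ ℕ.m<m+n (3 ^ c ℕ.+ 3 ^ c) (ℕ.m^n>0 3 c) ⟩
    3 ^ c ℕ.+ 3 ^ c ℕ.+ 3 ^ c    ≡⟨ triple (3 ^ c) ⟩
    3 ^ suc c                    ∎
    where
    open ℕ.≤-Reasoning
    triple : ∀ x → x ℕ.+ x ℕ.+ x ≡ 3 ℕ.* x
    triple = ℕ-solve-∀

  point-injective : ∀ {u w} → point u ≡ point w → u ≡ w
  point-injective {u} {w} eq = index-injective (3^-injective (begin
    3 ^ index u     ≡⟨ ∣xcoord∣ u ⟨
    ∣ xcoord u ∣    ≡⟨ cong (∣_∣ ∘ proj₁) eq ⟩
    ∣ xcoord w ∣    ≡⟨ ∣xcoord∣ w ⟩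
    3 ^ index w     ∎))
    where open ≡-Reasoning

  xcoord-difference : ∀ {u w} → index u < index w → HasSign (sgn w) (xcoord w - xcoord u)
  xcoord-difference {u} {w} u<w = hasSign-dominant (sgn w) (- xcoord u)
    (subst (_< 3 ^ index w) (sym (trans (ℤ.∣-i∣≡∣i∣ (xcoord u)) (∣xcoord∣ u))) (3^-mono-< u<w))

  xcoord-sum : ∀ {u v w} → index u < index w → index v < index w →
               HasSign (sgn w) (xcoord u + xcoord v + xcoord w)
  xcoord-sum {u} {v} {w} u<w v<w =
    subst (HasSign (sgn w)) (ℤ.+-comm (xcoord w) (xcoord u + xcoord v))
      (hasSign-dominant (sgn w) (xcoord u + xcoord v) (begin-strict
        ∣ xcoord u + xcoord v ∣         ≤⟨ ℤ.∣i+j∣≤∣i∣+∣j∣ (xcoord u) (xcoord v) ⟩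
        ∣ xcoord u ∣ ℕ.+ ∣ xcoord v ∣   ≡⟨ cong₂ ℕ._+_ (∣xcoord∣ u) (∣xcoord∣ v) ⟩
        3 ^ index u ℕ.+ 3 ^ index v     <⟨ 3^-sum-< u<w v<w ⟩
        3 ^ index w                     ∎))
    where open ℕ.≤-Reasoning

  record Oriented (s : Sign) (u v w : Vertex) : Set where
    constructor oriented
    field hasSign : HasSign s (orient (point u) (point v) (point w))

  oriented⇒≢0 : ∀ {s u v w} → Oriented s u v w → orient (point u) (point v) (point w) ≢ 0ℤ
  oriented⇒≢0 (oriented h) = hasSign⇒≢0 h

  -- Opaque: otherwise Agda's injectivity analysis of the case lemmas below normalises the
  -- ring-solver proofs inside these, which takes minutes.
  opaque
    oriented-rotate : ∀ {s u v w} → Oriented s u v w → Oriented s v w u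
    oriented-rotate {u = u} {v} {w} (oriented h) =
      oriented (subst (HasSign _) (orient-rotate (point u) (point v) (point w)) h)

    oriented-swap : ∀ {s u v w} → Oriented s u v w → Oriented (opposite s) v u w
    oriented-swap {u = u} {v} {w} (oriented h) =
      oriented (subst (HasSign _) (sym (orient-swap (point v) (point u) (point w))) (hasSign-neg h))

    oriented-increasing : ∀ {u v w} → index u < index v → index v < index w →
                          Oriented (sgn v Sign.* sgn w) u v w
    oriented-increasing {u} {v} {w} u<v v<w = oriented $
      subst₂ HasSign (sign-cube (sgn v) (sgn w)) (sym (orient-cubic (xcoord u) (xcoord v) (xcoord w)))
        (hasSign-* (hasSign-* (hasSign-* (xcoord-difference u<v) (xcoord-difference u<w))
                              (xcoord-difference v<w))
                   (xcoord-sum u<w v<w))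
      where
      u<w : index u < index w
      u<w = ℕ.<-trans u<v v<w
      sign-cube : ∀ s t → s Sign.* t Sign.* t Sign.* t ≡ s Sign.* t
      sign-cube Sign.+ Sign.+ = refl
      sign-cube Sign.+ Sign.- = refl
      sign-cube Sign.- Sign.+ = refl
      sign-cube Sign.- Sign.- = refl

  same-side : ∀ {s a b c d} → Oriented s a b c → Oriented s a b d →
              ¬ Separates (point a) (point b) (point c) (point d)
  same-side {s} (oriented hc) (oriented hd) (separates neg) =
    hasSign⁺⇒≮0 (subst (λ s → HasSign s _) (Sign.s*s≡+ s) (hasSign-* hc hd)) neg

  side-below : ∀ {a b z} → index z < index b → index b < index a →
               Oriented (opposite (sgn b Sign.* sgn a)) a b z
  side-below z<b b<a = oriented-rotate (oriented-rotate (oriented-swap (oriented-increasing z<b b<a)))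

  side-between : ∀ {a b z} → index b < index z → index z < index a →
                 Oriented (sgn z Sign.* sgn a) a b z
  side-between b<z z<a = oriented-rotate (oriented-rotate (oriented-increasing b<z z<a))

  side-above : ∀ {a b z} → index b < index a → index a < index z →
               Oriented (opposite (sgn a Sign.* sgn z)) a b z
  side-above b<a a<z = oriented-swap (oriented-increasing b<a a<z)

  line-side : ∀ {a b z} → index b < index a → z ≢ a → z ≢ b → ∃ λ s → Oriented s a b z
  line-side {a} {b} {z} b<a z≢a z≢b with ℕ.<-cmp (index z) (index b) | ℕ.<-cmp (index z) (index a)
  ... | tri< z<b _ _ | _              = _ , side-below z<b b<a
  ... | tri≈ _ z≡b _ | _              = ⊥-elim (z≢b (index-injective z≡b))
  ... | tri> _ _ b<z | tri< z<a _ _   = _ , side-between b<z z<a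
  ... | tri> _ _ _   | tri≈ _ z≡a _   = ⊥-elim (z≢a (index-injective z≡a))
  ... | tri> _ _ _   | tri> _ _ a<z   = _ , side-above b<a a<z

  orient-nonzero : ∀ {u v w} → u ≢ v → v ≢ w → u ≢ w → orient (point u) (point v) (point w) ≢ 0ℤ
  orient-nonzero {u} {v} {w} u≢v v≢w u≢w with ℕ.<-cmp (index u) (index v)
  ... | tri< u<v _ _ = oriented⇒≢0 (oriented-swap (proj₂ (line-side u<v (v≢w ∘ sym) (u≢w ∘ sym))))
  ... | tri≈ _ u≡v _ = ⊥-elim (u≢v (index-injective u≡v))
  ... | tri> _ _ v<u = oriented⇒≢0 (proj₂ (line-side v<u (u≢w ∘ sym) (v≢w ∘ sym)))

open CubicOrientation
open import Data.Nat using (_+_)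

no-separation-below : ∀ {a b c d} → index c < index b → index d < index b → index b < index a →
                      ¬ Separates (point a) (point b) (point c) (point d)
no-separation-below c<b d<b b<a = same-side (side-below c<b b<a) (side-below d<b b<a)

matchings-do-not-cross : ∀ {j j'} → j < j' →
  ¬ Crossing (point (j' , false)) (point (j' , true)) (point (j , false)) (point (j , true))
matchings-do-not-cross {j} {j'} j<j' (X , _) =
  no-separation-below (index-<-pair false false j<j') (index-<-pair true false j<j') (index-false<true j')
    (separates-swapˡ X)

data Leaf (k : ℕ) (t : Bool) : Vertex → Set where
  lower : ∀ {j} → j < k → Leaf k t (j , t)
  upper : ∀ {j} → k < j → Leaf k t (j , not t)

-- In each case both ends of one segment lie on the same side of the other; the two signs
-- agree definitionally once the parities are fixed.
opposite-spokes-do-not-cross : ∀ {k x y} → Leaf k false x → Leaf k true y →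
  ¬ Crossing (point (k , false)) (point x) (point (k , true)) (point y)
opposite-spokes-do-not-cross {k} (lower {j} j<k) (lower {j'} j'<k) (_ , Y) with ℕ.≤-<-connex j j'
... | inj₁ j≤j' = same-side (side-between (index-<-pair true false j'<k) (index-false<true k))
                            (side-below (index-≤-pair j≤j') (index-<-pair true true j'<k)) Y
... | inj₂ j'<j = same-side (side-between (index-<-pair true false j'<k) (index-false<true k))
                            (side-between (index-<-pair true false j'<j) (index-<-pair false true j<k)) Y
opposite-spokes-do-not-cross {k} (lower j<k) (upper k<j') (_ , Y) =
  no-separation-below (index-false<true k) (index-<-pair false true j<k) (index-<-pair true false k<j')
    (separates-swapˡ Y)
opposite-spokes-do-not-cross {k} (upper k<j) (lower j'<k) (X , _) =
  same-side (side-between (index-false<true k) (index-<-pair true true k<j))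
            (side-below (index-<-pair true false j'<k) (index-<-pair false true k<j))
    (separates-swapˡ X)
opposite-spokes-do-not-cross {k} (upper {j} k<j) (upper {j'} k<j') (X , Y) with ℕ.<-≤-connex j j'
... | inj₁ j<j' = same-side (side-between (index-false<true k) (index-<-pair true true k<j))
                            (side-above (index-<-pair false true k<j) (index-<-pair true false j<j'))
                    (separates-swapˡ X)
... | inj₂ j'≤j = same-side (side-below (index-false<true k) (index-<-pair true false k<j'))
                            (side-above (index-<-pair true false k<j') (index-≤-pair j'≤j))
                    (separates-swapˡ Y)

data StarEdge : ℕ → Vertex → Vertex → Set where
  matching : ∀ j → StarEdge 0 (j , false) (j , true)
  spoke : ∀ {k t v} → Leaf k t v → StarEdge (suc k) (k , t) v

starEdges-do-not-cross : ∀ {c a b a' b'} → StarEdge c a b → StarEdge c a' b' → a ≢ a' →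
                         ¬ Crossing (point a) (point b) (point a') (point b')
starEdges-do-not-cross (matching j) (matching j') a≢a' X with ℕ.<-cmp j j'
... | tri< j<j' _ _ = matchings-do-not-cross j<j' (crossing-sym X)
... | tri≈ _ refl _ = a≢a' refl
... | tri> _ _ j'<j = matchings-do-not-cross j'<j X
starEdges-do-not-cross (spoke {t = false} l) (spoke {t = true} l') _ X = opposite-spokes-do-not-cross l l' X
starEdges-do-not-cross (spoke {t = true} l) (spoke {t = false} l') _ X =
  opposite-spokes-do-not-cross l' l (crossing-sym X)
starEdges-do-not-cross (spoke {t = false} _) (spoke {t = false} _) a≢a' _ = a≢a' refl
starEdges-do-not-cross (spoke {t = true} _) (spoke {t = true} _) a≢a' _ = a≢a' refl

-- The pair containing the centre of an edge between pairs j ≠ j' with parities t, t'.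
centrePair : Bool → Bool → ℕ → ℕ → ℕ
centrePair false false = _⊔_
centrePair true true = _⊔_
centrePair false true = _⊓_
centrePair true false = _⊓_

colour : Vertex → Vertex → ℕ
colour (j , t) (j' , t') with j ℕ.≟ j'
... | yes _ = 0
... | no _ = suc (centrePair t t' j j')

colour-same-pair : ∀ j t t' → colour (j , t) (j , t') ≡ 0
colour-same-pair j _ _ with j ℕ.≟ j
... | yes _ = refl
... | no j≢j = ⊥-elim (j≢j refl)

colour-different-pairs : ∀ {j j'} t t' → j ≢ j' → colour (j , t) (j' , t') ≡ suc (centrePair t t' j j')
colour-different-pairs {j} {j'} _ _ j≢j' with j ℕ.≟ j'
... | yes j≡j' = ⊥-elim (j≢j' j≡j')
... | no _ = refl

centrePair-comm : ∀ t t' j j' → centrePair t t' j j' ≡ centrePair t' t j' j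
centrePair-comm false false = ℕ.⊔-comm
centrePair-comm true true = ℕ.⊔-comm
centrePair-comm false true = ℕ.⊓-comm
centrePair-comm true false = ℕ.⊓-comm

colour-sym : ∀ u w → colour u w ≡ colour w u
colour-sym (j , t) (j' , t') with j ℕ.≟ j'
... | yes refl = sym (colour-same-pair j t' t)
... | no j≢j' =
  trans (cong suc (centrePair-comm t t' j j')) (sym (colour-different-pairs t' t (j≢j' ∘ sym)))

centrePair-same : ∀ {j k} t → j ≤ k → centrePair t t k j ≡ k
centrePair-same false = ℕ.m≥n⇒m⊔n≡m
centrePair-same true = ℕ.m≥n⇒m⊔n≡m

centrePair-opposite : ∀ {j k} t → k ≤ j → centrePair t (not t) k j ≡ k
centrePair-opposite false = ℕ.m≤n⇒m⊓n≡m
centrePair-opposite true = ℕ.m≤n⇒m⊓n≡m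

starEdge-colour : ∀ {c u w} → StarEdge c u w → colour u w ≡ c
starEdge-colour (matching j) = colour-same-pair j false true
starEdge-colour (spoke {k} {t} (lower j<k)) =
  trans (colour-different-pairs t t (ℕ.>⇒≢ j<k)) (cong suc (centrePair-same t (ℕ.<⇒≤ j<k)))
starEdge-colour (spoke {k} {t} (upper k<j)) =
  trans (colour-different-pairs t (not t) (ℕ.<⇒≢ k<j)) (cong suc (centrePair-opposite t (ℕ.<⇒≤ k<j)))

matching-within-pair : ∀ {j} t t' → (j , t) ≢ (j , t') →
                       StarEdge 0 (j , t) (j , t') ⊎ StarEdge 0 (j , t') (j , t)
matching-within-pair false true _ = inj₁ (matching _)
matching-within-pair true false _ = inj₂ (matching _)
matching-within-pair false false u≢w = ⊥-elim (u≢w refl)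
matching-within-pair true true u≢w = ⊥-elim (u≢w refl)

spoke-between-pairs : ∀ {j j'} → j < j' → ∀ t t' →
                      ∃ λ c → StarEdge c (j , t) (j' , t') ⊎ StarEdge c (j' , t') (j , t)
spoke-between-pairs j<j' false false = _ , inj₂ (spoke (lower j<j'))
spoke-between-pairs j<j' true true = _ , inj₂ (spoke (lower j<j'))
spoke-between-pairs j<j' false true = _ , inj₁ (spoke (upper j<j'))
spoke-between-pairs j<j' true false = _ , inj₁ (spoke (upper j<j'))

edge-starEdge : ∀ {u w} → u ≢ w → ∃ λ c → StarEdge c u w ⊎ StarEdge c w u
edge-starEdge {j , t} {j' , t'} u≢w with ℕ.<-cmp j j'
... | tri< j<j' _ _ = spoke-between-pairs j<j' t t'
... | tri≈ _ refl _ = 0 , matching-within-pair t t' u≢w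
... | tri> _ _ j'<j = map₂ Sum.swap (spoke-between-pairs j'<j t' t)

starEdge-of-colour : ∀ {c u w} → u ≢ w → colour u w ≡ c → StarEdge c u w ⊎ StarEdge c w u
starEdge-of-colour {u = u} {w} u≢w uw∈c with edge-starEdge u≢w
... | _ , inj₁ e = inj₁ (subst (λ c → StarEdge c u w) (trans (sym (starEdge-colour e)) uw∈c) e)
... | _ , inj₂ e =
  inj₂ (subst (λ c → StarEdge c w u) (trans (sym (starEdge-colour e)) (trans (colour-sym w u) uw∈c)) e)

same-colour-edges-do-not-cross : ∀ {u w u' w'} → u ≢ w → u' ≢ w' → u ≢ u' → u ≢ w' → w ≢ u' → w ≢ w' →
  colour u w ≡ colour u' w' → ¬ Crossing (point u) (point w) (point u') (point w')
same-colour-edges-do-not-cross u≢w u'≢w' u≢u' u≢w' w≢u' w≢w' same X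
  with starEdge-of-colour u≢w refl | starEdge-of-colour u'≢w' (sym same)
... | inj₁ e | inj₁ e' = starEdges-do-not-cross e e' u≢u' X
... | inj₁ e | inj₂ e' = starEdges-do-not-cross e e' u≢w' (crossing-swapʳ X)
... | inj₂ e | inj₁ e' = starEdges-do-not-cross e e' w≢u' (crossing-swapˡ X)
... | inj₂ e | inj₂ e' = starEdges-do-not-cross e e' w≢w' (crossing-swapˡ (crossing-swapʳ X))

centrePair-< : ∀ {m j j'} t t' → j < m → j' < m → centrePair t t' j j' < m
centrePair-< false false j<m j'<m = ℕ.⊔-lub j<m j'<m
centrePair-< true true j<m j'<m = ℕ.⊔-lub j<m j'<m
centrePair-< {j = j} {j'} false true j<m _ = ℕ.m<n⇒m⊓o<n j' j<m
centrePair-< {j = j} {j'} true false j<m _ = ℕ.m<n⇒m⊓o<n j' j<m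

colour-< : ∀ {m} u w → proj₁ u < m → proj₁ w < m → colour u w < m + 1
colour-< {m} (j , t) (j' , t') j<m j'<m =
  subst (colour (j , t) (j' , t') <_) (ℕ.+-comm 1 m) (s≤s colour≤m)
  where
  colour≤m : colour (j , t) (j' , t') ≤ m
  colour≤m with j ℕ.≟ j'
  ... | yes _ = z≤n
  ... | no _ = centrePair-< t t' j<m j'<m

centre : ℕ → Vertex → Vertex
centre zero (j , _) = j , false
centre (suc k) (j , t) with j ℕ.≤? k
... | yes _ = k , t
... | no _ = k , not t

centre-≤ : ∀ {j k t} → j ≤ k → centre (suc k) (j , t) ≡ (k , t)
centre-≤ {j} {k} j≤k with j ℕ.≤? k
... | yes _ = refl
... | no j≰k = ⊥-elim (j≰k j≤k)

centre-> : ∀ {j k t} → k < j → centre (suc k) (j , t) ≡ (k , not t)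
centre-> {j} {k} k<j with j ℕ.≤? k
... | yes j≤k = ⊥-elim (ℕ.<⇒≱ k<j j≤k)
... | no _ = refl

centre-idem : ∀ c v → centre c (centre c v) ≡ centre c v
centre-idem zero _ = refl
centre-idem (suc k) (j , t) with j ℕ.≤? k
... | yes _ = centre-≤ ℕ.≤-refl
... | no _ = centre-≤ ℕ.≤-refl

starEdge-centre : ∀ {c u w} → StarEdge c u w → centre c u ≡ u × centre c w ≡ u
starEdge-centre (matching j) = refl , refl
starEdge-centre (spoke (lower j<k)) = centre-≤ ℕ.≤-refl , centre-≤ (ℕ.<⇒≤ j<k)
starEdge-centre (spoke {k} {t} (upper k<j)) =
  centre-≤ ℕ.≤-refl , trans (centre-> k<j) (cong (k ,_) (not-involutive t))

centre-fixed : ∀ {j k t} → (j , t) ≡ centre (suc k) (j , t) → j ≡ k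
centre-fixed {j} {k} {t} fixed with ℕ.≤-<-connex j k
... | inj₁ j≤k = cong proj₁ (trans fixed (centre-≤ j≤k))
... | inj₂ k<j = ⊥-elim (not-¬ refl (cong proj₂ (trans fixed (centre-> k<j))))

leaf-of-centre : ∀ {k t w} → centre (suc k) w ≡ (k , t) → w ≢ (k , t) → Leaf k t w
leaf-of-centre {k} {t} {j , s} w↦kt w≢kt with ℕ.≤-<-connex j k
... | inj₁ j≤k with trans (sym (centre-≤ j≤k)) w↦kt
...   | refl = lower (ℕ.≤∧≢⇒< j≤k (w≢kt ∘ cong (_, s)))
leaf-of-centre {k} {t} {j , s} w↦kt w≢kt | inj₂ k<j with trans (sym (centre-> k<j)) w↦kt
...   | refl = subst (λ b → Leaf k (not s) (j , b)) (not-involutive s) (upper k<j)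

centre-starEdge : ∀ {c u w} → u ≢ w → u ≡ centre c u → centre c w ≡ u → StarEdge c u w
centre-starEdge {zero} {j , false} {.j , true} _ refl refl = matching j
centre-starEdge {zero} {j , false} {.j , false} u≢w refl refl = ⊥-elim (u≢w refl)
centre-starEdge {suc k} {j , t} u≢w u-fixed w↦u with centre-fixed u-fixed
... | refl = spoke (leaf-of-centre w↦u (u≢w ∘ sym))

colour-isStarForest : ∀ c → IsStarForest (λ u w → colour u w ≡ c) (centre c)
colour-isStarForest c = record
  { ctr-idem = centre-idem c
  ; edge⇒star = edge⇒star
  ; star⇒edge = star⇒edge
  }
  where
  edge⇒star : ∀ {u w} → u ≢ w → colour u w ≡ c →
              centre c u ≡ centre c w × (u ≡ centre c u ⊎ w ≡ centre c w)
  edge⇒star u≢w uw∈c with starEdge-of-colour u≢w uw∈c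
  ... | inj₁ e = let (u↦u , w↦u) = starEdge-centre e in trans u↦u (sym w↦u) , inj₁ (sym u↦u)
  ... | inj₂ e = let (w↦w , u↦w) = starEdge-centre e in trans u↦w (sym w↦w) , inj₂ (sym w↦w)

  star⇒edge : ∀ {u w} → u ≢ w → centre c u ≡ centre c w → (u ≡ centre c u ⊎ w ≡ centre c w) →
              colour u w ≡ c
  star⇒edge {u} {w} u≢w same (inj₁ u-fixed) =
    starEdge-colour (centre-starEdge u≢w u-fixed (trans (sym same) (sym u-fixed)))
  star⇒edge {u} {w} u≢w same (inj₂ w-fixed) =
    trans (colour-sym u w) (starEdge-colour (centre-starEdge (u≢w ∘ sym) w-fixed (trans same (sym w-fixed))))

module Construction (n : ℕ) where

  vertexOf : Fin n → Vertex
  vertexOf = vertex ∘ toℕ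

  vertexOf-injective : ∀ {a b} → vertexOf a ≡ vertexOf b → a ≡ b
  vertexOf-injective {a} {b} eq =
    toℕ-injective (trans (sym (index-vertex (toℕ a))) (trans (cong index eq) (index-vertex (toℕ b))))

  vertexOf-≢ : ∀ {a b} → a ≢ b → vertexOf a ≢ vertexOf b
  vertexOf-≢ a≢b = a≢b ∘ vertexOf-injective

  preimage? : ∀ u → Dec (∃ λ a → vertexOf a ≡ u)
  preimage? u with index u ℕ.<? n
  ... | yes u<n = yes (fromℕ< u<n , trans (cong vertex (toℕ-fromℕ< u<n)) (vertex-index u))
  ... | no u≮n = no λ (a , a↦u) →
    u≮n (subst (_< n) (trans (sym (index-vertex (toℕ a))) (cong index a↦u)) (toℕ<n a))

  points : Fin n → Point
  points = point ∘ vertexOf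

  general-position : GeneralPosition points
  general-position =
      (λ _ _ a≢b → vertexOf-≢ a≢b ∘ point-injective)
    , (λ _ _ _ a≢b b≢c a≢c → orient-nonzero (vertexOf-≢ a≢b) (vertexOf-≢ b≢c) (vertexOf-≢ a≢c))

  colouring : Fin n → Fin n → Fin (⌈ n /2⌉ + 1)
  colouring a b =
    fromℕ< (colour-< (vertexOf a) (vertexOf b) (vertex-pair-< (toℕ<n a)) (vertex-pair-< (toℕ<n b)))

  toℕ-colouring : ∀ a b → toℕ (colouring a b) ≡ colour (vertexOf a) (vertexOf b)
  toℕ-colouring a b = toℕ-fromℕ< _

  colouring-sym : ∀ a b → colouring a b ≡ colouring b a
  colouring-sym a b = toℕ-injective (begin
    toℕ (colouring a b)               ≡⟨ toℕ-colouring a b ⟩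
    colour (vertexOf a) (vertexOf b)  ≡⟨ colour-sym (vertexOf a) (vertexOf b) ⟩
    colour (vertexOf b) (vertexOf a)  ≡⟨ toℕ-colouring b a ⟨
    toℕ (colouring b a)               ∎)
    where open ≡-Reasoning

  colouring≡⇔ : ∀ a b {i} → colour (vertexOf a) (vertexOf b) ≡ toℕ i ⇔ colouring a b ≡ i
  colouring≡⇔ a b = mk⇔ (λ eq → toℕ-injective (trans (toℕ-colouring a b) eq))
                        (λ eq → trans (sym (toℕ-colouring a b)) (cong toℕ eq))

  colour-class-starForest : ∀ i → StarForest (ColourClass colouring i)
  colour-class-starForest i =
    isStarForest⇒starForest $ isStarForest-resp-⇔ (λ {a} {b} → colouring≡⇔ a b) $
      Restriction.restrict-isStarForest vertexOf vertexOf-injective preimage? (colour-isStarForest (toℕ i))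

  colour-class-plane : ∀ i → Plane points (ColourClass colouring i)
  colour-class-plane i a b c d (_ , ab∈i) (_ , cd∈i) (a≢b , a≢c , a≢d , b≢c , b≢d , c≢d , X , Y) =
    same-colour-edges-do-not-cross (vertexOf-≢ a≢b) (vertexOf-≢ c≢d) (vertexOf-≢ a≢c) (vertexOf-≢ a≢d)
      (vertexOf-≢ b≢c) (vertexOf-≢ b≢d)
      (trans (Equivalence.from (colouring≡⇔ a b) ab∈i) (sym (Equivalence.from (colouring≡⇔ c d) cd∈i)))
      (separates X , separates Y)

-- The construction also works for n = 0.
theorem4 : (n : ℕ) → 1 ≤ n →
    ∃ λ (p : Fin n → Point) →
      GeneralPosition p × PlaneStarForestPartition p (⌈ n /2⌉ + 1)
theorem4 n _ = points , general-position , colouring , colouring-sym ,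
               λ i → colour-class-starForest i , colour-class-plane i
  where open Construction n
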